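{- Let $r\ge 4$ be a fixed integer. The number of pairwise non-congruent triangles associated with $D(4)$-triples and having shortest side $r$ equals the number of positive divisors $a$ of $r^2-4$ satisfying $$\frac{\sqrt{5r^2-16}-r}{2}<a<\sqrt{r^2-4}.$$
   Context: A $D(4)$-triple is a set of three distinct positive integers such that the product of any two distinct elements, increased by $4$, is a perfect square. For a $D(4)$-triple $\{a,b,c\}$ with $a<b<c$, put $r=\sqrt{ab+4}$, $s=\sqrt{ac+4}$, $t=\sqrt{bc+4}$; these are positive integers with $r<s<t$. If $r+s>t$, the (non-degenerate) triangle with side lengths $r,s,t$ is called the triangle associated with the $D(4)$-triple $\{a,b,c\}$; if $r+s\le t$, no triangle is associated with $\{a,b,c\}$. -}

module Defs where

open import Data.Nat using (ℕ; _+_; _*_; _∸_; _<_; _≤_)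
open import Data.Nat.Divisibility using (_∣_)
open import Data.Fin using (Fin)
open import Data.Integer using (+_)
open import Data.Rational.Unnormalised as ℚ using (ℚᵘ; mkℚᵘ; 0ℚᵘ)
open import Data.List using (List; []; _∷_)
open import Data.List.Membership.Propositional using (_∈_)
open import Data.List.Relation.Unary.All using (All)
open import Data.List.Relation.Binary.Permutation.Propositional using (_↭_; ↭-setoid)
open import Data.Product using (Σ; ∃; _×_; proj₁)
open import Data.Sum using (_⊎_)
open import Function using (_∘_)
open import Function.Bundles using (Inverse)
open import Level using (0ℓ)
open import Relation.Binary.Bundles using (Setoid)
import Relation.Binary.Construct.On as On
open import Relation.Binary.PropositionalEquality using (_≡_)
import Relation.Binary.PropositionalEquality as ≡

-- A D(4)-triple {a, b, c}, listed in increasing order, together with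
-- r = √(ab+4), s = √(ac+4), t = √(bc+4).  As r, s, t are natural numbers,
-- the three equations determine them uniquely.
record D4Triple : Set where
  field
    a b c : ℕ
    0<a   : 0 < a
    a<b   : a < b
    b<c   : b < c
    r s t : ℕ
    r²≡   : r * r ≡ a * b + 4
    s²≡   : s * s ≡ a * c + 4
    t²≡   : t * t ≡ b * c + 4

-- Non-degenerate triangles with integer side lengths.  The three strict
-- inequalities also force the sides to be positive.
record Triangle : Set where
  field
    x y z : ℕ
    x<y+z : x < y + z
    y<x+z : y < x + z
    z<x+y : z < x + y

sides : Triangle → List ℕ
sides T = x ∷ y ∷ z ∷ []
  where open Triangle T

-- For r + s ≤ t no T satisfies this, as r, s, t are not then the sides of
-- a Triangle.
_IsAssociatedWith_ : Triangle → D4Triple → Set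
T IsAssociatedWith D = sides T ↭ r ∷ s ∷ t ∷ []
  where open D4Triple D

HasShortestSide : ℕ → Triangle → Set
HasShortestSide ρ T = ρ ∈ sides T × All (ρ ≤_) (sides T)

-- Equality in this setoid is congruence of triangles: the side lengths agree
-- up to order.
AssociatedTriangles : ℕ → Setoid 0ℓ 0ℓ
AssociatedTriangles ρ = On.setoid {B = Carrier} ↭-setoid (sides ∘ proj₁)
  where
  Carrier : Set
  Carrier = Σ Triangle λ T → (∃ λ D → T IsAssociatedWith D) × HasShortestSide ρ T

-- A real number, given by the rationals strictly below and strictly above it.
-- Only comparisons with rationals are needed, so the Dedekind axioms are not
-- imposed.
record Cut : Set₁ where
  field
    Below Above : ℚᵘ → Set

open Cut

infix  4 _<ᶜ_ _ᶜ<_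
infixl 6 _-ᶜ_
infixl 7 _/2
infix  8 √_

_<ᶜ_ : Cut → ℚᵘ → Set
x <ᶜ q = Above x q

_ᶜ<_ : ℚᵘ → Cut → Set
q ᶜ< x = Below x q

-- Meaningful for a non-negative argument only.
√_ : ℚᵘ → Cut
Below (√ x) q = q ℚ.< 0ℚᵘ ⊎ q ℚ.* q ℚ.< x
Above (√ x) q = 0ℚᵘ ℚ.< q × x ℚ.< q ℚ.* q

-- q < x - p  iff  q + p < x.
_-ᶜ_ : Cut → ℚᵘ → Cut
Below (x -ᶜ p) q = Below x (q ℚ.+ p)
Above (x -ᶜ p) q = Above x (q ℚ.+ p)

-- q < x / 2  iff  q + q < x.
_/2 : Cut → Cut
Below (x /2) q = Below x (q ℚ.+ q)
Above (x /2) q = Above x (q ℚ.+ q)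

-- n / 1; the second argument of mkℚᵘ is the denominator minus one.
fromℕ : ℕ → ℚᵘ
fromℕ n = mkℚᵘ (+ n) 0

record IsAdmissibleDivisor (r a : ℕ) : Set where
  field
    positive : 0 < a
    divides  : a ∣ r * r ∸ 4
    lower    : (√ (fromℕ (5 * (r * r)) ℚ.- fromℕ 16) -ᶜ fromℕ r) /2 <ᶜ fromℕ a
    upper    : fromℕ a ᶜ< √ (fromℕ (r * r) ℚ.- fromℕ 4)

-- Compared by the underlying number, ignoring the proof of admissibility.
AdmissibleDivisors : ℕ → Setoid 0ℓ 0ℓ
AdmissibleDivisors r = On.setoid {B = ∃ (IsAdmissibleDivisor r)} (≡.setoid ℕ) proj₁

-- S has exactly n elements up to its equivalence.
HasCardinality : Setoid 0ℓ 0ℓ → ℕ → Set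
HasCardinality S n = Inverse S (≡.setoid (Fin n))

{-# OPTIONS --safe #-}

-- Put x = (rs - at)/2 and y = (rt - bs)/2, which are positive integers.  Then
-- 2s = ay + rx, 2t = bx + ry and b(x² - 4) = a(y² - 4).  The triangle
-- inequality t < r + s forces x = y = 2, that is s = a + r and t = b + r.
-- Since a < b, x = 1 would give y < 1.  For x ≥ 3 one has y = x + k with k ≥ 1,
-- and with e = b - a the inequality reads ex + rk < 2r + ak.  As ex > 2ak, it
-- fails for k ≥ 2; for k = 1 it says ex - a < r, whereas (ex - a)² = ab + 4e² ≥ r².
--
-- Hence the associated triangles with shortest side r are the (r, a + r, b + r)
-- with ab = r² - 4 and a < b < a + r, where b < a + r amounts to
-- 5r² - 16 < (2a + r)²; conversely c = a + b + 2r yields each of them.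

module Submission where

open import Data.Fin as Fin using (Fin)
import Data.Integer as ℤ
import Data.Integer.Properties as ℤ
open import Data.List using (List; []; _∷_; filter; length; lookup; upTo)
open import Data.List.Membership.Propositional using (_∈_)
open import Data.List.Membership.Propositional.Properties
  using (∈-lookup; ∈-filter⁺; ∈-filter⁻; ∈-upTo⁺)
open import Data.List.Relation.Binary.Permutation.Propositional
  using (_↭_; ↭-refl; ↭-reflexive; ↭-sym; ↭-trans)
open import Data.List.Relation.Binary.Permutation.Propositional.Properties
  using (All-resp-↭; ∈-resp-↭; drop-∷)
open import Data.List.Relation.Unary.All as All using (All)
import Data.List.Relation.Unary.AllPairs as AllPairs
open import Data.List.Relation.Unary.Any using (here; there; index)
open import Data.List.Relation.Unary.Any.Properties using (lookup-index)
open import Data.List.Relation.Unary.Unique.Propositional using (Unique)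
open import Data.List.Relation.Unary.Unique.Propositional.Properties using (filter⁺; upTo⁺)
open import Data.Nat
open import Data.Nat.Divisibility
open import Data.Nat.Primality using (euclidsLemma; prime[2])
open import Data.Nat.ListAction using (sum)
open import Data.Nat.ListAction.Properties using (sum-↭)
open import Data.Nat.Properties
open import Data.Nat.Tactic.RingSolver using (solve)
open import Data.Product
open import Data.Rational.Unnormalised as ℚ using (mkℚᵘ; *<*; 0ℚᵘ)
import Data.Rational.Unnormalised.Properties as ℚ
open import Data.Sum using (inj₁; inj₂; [_,_]′)
open import Defs
open import Function using (id)
open import Function.Bundles using (Inverse)
import Function.Construct.Composition as Compose
open import Relation.Binary.Bundles using (Setoid)
import Relation.Binary.Construct.On as On
open import Relation.Binary.PropositionalEquality
open import Relation.Nullary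
open import Relation.Nullary.Decidable using (map′; _×-dec_; _⊎-dec_)
open import Relation.Unary using (Decidable)

-- Squares and differences of natural numbers.

m*m<n*n⇒m<n : ∀ {m n} → m * m < n * n → m < n
m*m<n*n⇒m<n m²<n² = ≰⇒> λ n≤m → <⇒≱ m²<n² (*-mono-≤ n≤m n≤m)

m*m≡n*n⇒m≡n : ∀ {m n} → m * m ≡ n * n → m ≡ n
m*m≡n*n⇒m≡n {m} {n} m²≡n² = ≤-antisym
  (≮⇒≥ λ n<m → <⇒≢ (*-mono-< n<m n<m) (sym m²≡n²))
  (≮⇒≥ λ m<n → <⇒≢ (*-mono-< m<n m<n) m²≡n²)

m<n⇒∃k : ∀ {m n} → m < n → ∃ λ k → 0 < k × n ≡ m + k
m<n⇒∃k {m} m<n with k , eq ← m≤n⇒∃[o]m+o≡n m<n = suc k , z<s , sym (trans (+-suc m k) eq)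

-- The half-differences x and y and their relations.

-- By the three equations (rs)² - (at)² = 4(ab + ac + 4 - a²), which is positive because a ≤ c.
-- Exchanging a with b and s with t produces y.
rs≡at+2x : ∀ {a b c r s t} → a ≤ c →
  r * r ≡ a * b + 4 → s * s ≡ a * c + 4 → t * t ≡ b * c + 4 →
  ∃ λ x → 0 < x × r * s ≡ a * t + 2 * x
rs≡at+2x {a} {b} {c} {r} {s} {t} a≤c r² s² t² =
  let k , 0<k , rs = m<n⇒∃k at<rs
      divides x eq = 2∣k k rs
      eq′ = trans eq (*-comm x 2)
  in x , n≢0⇒n>0 (λ x≡0 → <⇒≢ 0<k (sym (trans eq (cong (_* 2) x≡0)))) , trans rs (cong (a * t +_) eq′)
  where
  open ≤-Reasoning
  [at]² : a * t * (a * t) ≡ a * a * (b * c) + 4 * (a * a)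
  [at]² = begin-equality
    a * t * (a * t)                 ≡⟨ solve (a ∷ t ∷ []) ⟩
    a * a * (t * t)                 ≡⟨ cong (a * a *_) t² ⟩
    a * a * (b * c + 4)             ≡⟨ solve (a ∷ b ∷ c ∷ []) ⟩
    a * a * (b * c) + 4 * (a * a)   ∎
  [rs]² : r * s * (r * s) ≡ a * a * (b * c) + 4 * (a * b + a * c + 4)
  [rs]² = begin-equality
    r * s * (r * s)                 ≡⟨ solve (r ∷ s ∷ []) ⟩
    (r * r) * (s * s)               ≡⟨ cong₂ _*_ r² s² ⟩
    (a * b + 4) * (a * c + 4)       ≡⟨ solve (a ∷ b ∷ c ∷ []) ⟩
    a * a * (b * c) + 4 * (a * b + a * c + 4)   ∎
  at<rs : a * t < r * s
  at<rs = m*m<n*n⇒m<n (begin-strict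
    a * t * (a * t)                            ≡⟨ [at]² ⟩
    a * a * (b * c) + 4 * (a * a)              <⟨ +-monoʳ-< (a * a * (b * c)) (*-monoʳ-< 4 (begin-strict
      a * a               ≤⟨ *-monoʳ-≤ a a≤c ⟩
      a * c               ≤⟨ m≤n+m (a * c) (a * b) ⟩
      a * b + a * c       <⟨ m<m+n (a * b + a * c) z<s ⟩
      a * b + a * c + 4   ∎)) ⟩
    a * a * (b * c) + 4 * (a * b + a * c + 4)  ≡⟨ [rs]² ⟨
    r * s * (r * s)                            ∎)
  -- Expanding (at + k)² = (rs)² shows that k² is even, and 2 is prime.
  2∣k : ∀ k → r * s ≡ a * t + k → 2 ∣ k
  2∣k k rs = [ id , id ]′ (euclidsLemma k k prime[2]
    (∣m+n∣m⇒∣n (subst (2 ∣_) (sym eq) (m∣m*n (2 * (a * b + a * c + 4)))) (m∣m*n (a * t * k + 2 * (a * a)))))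
    where
    eq : 2 * (a * t * k + 2 * (a * a)) + k * k ≡ 2 * (2 * (a * b + a * c + 4))
    eq = +-cancelˡ-≡ (a * a * (b * c)) _ _ (begin-equality
      a * a * (b * c) + (2 * (a * t * k + 2 * (a * a)) + k * k) ≡⟨ solve (a ∷ b ∷ c ∷ t ∷ k ∷ []) ⟩
      (a * a * (b * c) + 4 * (a * a)) + (2 * (a * t * k) + k * k) ≡⟨ cong (_+ (2 * (a * t * k) + k * k)) [at]² ⟨
      a * t * (a * t) + (2 * (a * t * k) + k * k) ≡⟨ solve (a ∷ t ∷ k ∷ []) ⟩
      (a * t + k) * (a * t + k) ≡⟨ cong₂ _*_ rs rs ⟨
      r * s * (r * s) ≡⟨ [rs]² ⟩
      a * a * (b * c) + 4 * (a * b + a * c + 4) ≡⟨ solve (a ∷ b ∷ c ∷ []) ⟩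
      a * a * (b * c) + 2 * (2 * (a * b + a * c + 4)) ∎)

-- Multiply rs = at + 2x by r and insert rt = bs + 2y. As r² = ab + 4, the term abs cancels and 4s =
-- 2(ay + rx) remains.
2s≡ay+rx : ∀ {a b r s t x y} → r * r ≡ a * b + 4 →
  r * s ≡ a * t + 2 * x → r * t ≡ b * s + 2 * y → 2 * s ≡ a * y + r * x
2s≡ay+rx {a} {b} {r} {s} {t} {x} {y} r² rs rt =
  *-cancelˡ-≡ _ _ 2 (+-cancelˡ-≡ (a * b * s) _ _ (begin
    a * b * s + 2 * (2 * s)             ≡⟨ solve (a ∷ b ∷ s ∷ []) ⟩
    (a * b + 4) * s                     ≡⟨ cong (_* s) r² ⟨
    r * r * s                           ≡⟨ *-assoc r r s ⟩
    r * (r * s)                         ≡⟨ cong (r *_) rs ⟩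
    r * (a * t + 2 * x)                 ≡⟨ solve (a ∷ r ∷ t ∷ x ∷ []) ⟩
    a * (r * t) + 2 * (r * x)           ≡⟨ cong (λ u → a * u + 2 * (r * x)) rt ⟩
    a * (b * s + 2 * y) + 2 * (r * x)   ≡⟨ solve (a ∷ b ∷ r ∷ s ∷ x ∷ y ∷ []) ⟩
    a * b * s + 2 * (a * y + r * x)     ∎))
  where open ≡-Reasoning

-- b(x² - 4) = a(y² - 4), from b s² - a t² = 4 (b - a); written without subtraction.
bx²+4a≡ay²+4b : ∀ {a b c r s t x y} →
  r * r ≡ a * b + 4 → s * s ≡ a * c + 4 → t * t ≡ b * c + 4 →
  2 * s ≡ a * y + r * x → 2 * t ≡ b * x + r * y →
  b * (x * x) + 4 * a ≡ a * (y * y) + 4 * b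
bx²+4a≡ay²+4b {a} {b} {c} {r} {s} {t} {x} {y} r² s² t² 2s 2t =
  -- Both b(2s)² + 16a and a(2t)² + 16b equal 4abc + 16a + 16b. The cancelled summand is what their
  -- expansions in x and y share.
  *-cancelˡ-≡ _ _ 4 (+-cancelˡ-≡ (2 * (a * b * (r * (x * y))) + a * b * (a * (y * y) + b * (x * x))) _ _ (begin
    2 * (a * b * (r * (x * y))) + a * b * (a * (y * y) + b * (x * x)) + 4 * (b * (x * x) + 4 * a)
      ≡⟨ solve (a ∷ b ∷ r ∷ x ∷ y ∷ []) ⟩
    2 * (a * b * (r * (x * y))) + a * b * a * (y * y) + (a * b + 4) * (b * (x * x)) + 16 * a
      ≡⟨ cong (λ u → 2 * (a * b * (r * (x * y))) + a * b * a * (y * y) + u * (b * (x * x)) + 16 * a) r² ⟨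
    2 * (a * b * (r * (x * y))) + a * b * a * (y * y) + r * r * (b * (x * x)) + 16 * a
      ≡⟨ solve (a ∷ b ∷ r ∷ x ∷ y ∷ []) ⟩
    b * ((a * y + r * x) * (a * y + r * x)) + 16 * a
      ≡⟨ cong (λ u → b * (u * u) + 16 * a) 2s ⟨
    b * (2 * s * (2 * s)) + 16 * a
      ≡⟨ solve (a ∷ b ∷ s ∷ []) ⟩
    4 * b * (s * s) + 16 * a
      ≡⟨ cong (λ u → 4 * b * u + 16 * a) s² ⟩
    4 * b * (a * c + 4) + 16 * a
      ≡⟨ solve (a ∷ b ∷ c ∷ []) ⟩
    4 * a * (b * c + 4) + 16 * b
      ≡⟨ cong (λ u → 4 * a * u + 16 * b) t² ⟨
    4 * a * (t * t) + 16 * b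
      ≡⟨ solve (a ∷ b ∷ t ∷ []) ⟩
    a * (2 * t * (2 * t)) + 16 * b
      ≡⟨ cong (λ u → a * (u * u) + 16 * b) 2t ⟩
    a * ((b * x + r * y) * (b * x + r * y)) + 16 * b
      ≡⟨ solve (a ∷ b ∷ r ∷ x ∷ y ∷ []) ⟩
    2 * (a * b * (r * (x * y))) + a * b * b * (x * x) + r * r * (a * (y * y)) + 16 * b
      ≡⟨ cong (λ u → 2 * (a * b * (r * (x * y))) + a * b * b * (x * x) + u * (a * (y * y)) + 16 * b) r² ⟩
    2 * (a * b * (r * (x * y))) + a * b * b * (x * x) + (a * b + 4) * (a * (y * y)) + 16 * b
      ≡⟨ solve (a ∷ b ∷ r ∷ x ∷ y ∷ []) ⟩
    2 * (a * b * (r * (x * y))) + a * b * (a * (y * y) + b * (x * x)) + 4 * (a * (y * y) + 4 * b) ∎))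
  where open ≡-Reasoning

-- The triangle inequality forces x = y = 2.

-- With b = a + e the equation says a(y² - x²) = e(x² - 4), and the right side is positive.
2<x⇒x<y : ∀ {a e x y} → 0 < e → 2 < x →
  (a + e) * (x * x) + 4 * a ≡ a * (y * y) + 4 * (a + e) → x < y
2<x⇒x<y {a} {e} {x} {y} 0<e 2<x eq = ≰⇒> λ y≤x → <-irrefl (sym eq) (begin-strict
  a * (y * y) + 4 * (a + e)      ≤⟨ +-monoˡ-≤ _ (*-monoʳ-≤ a (*-mono-≤ y≤x y≤x)) ⟩
  a * (x * x) + 4 * (a + e)      ≡⟨ solve (a ∷ e ∷ x ∷ []) ⟩
  (a * (x * x) + 4 * a) + e * 4 <⟨ +-monoʳ-< (a * (x * x) + 4 * a) (*-monoʳ-< e {{>-nonZero 0<e}} (*-mono-< 2<x 2<x)) ⟩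
  (a * (x * x) + 4 * a) + e * (x * x) ≡⟨ solve (a ∷ e ∷ x ∷ []) ⟩
  (a + e) * (x * x) + 4 * a ∎)
  where open ≤-Reasoning

module _ {a e x k : ℕ} (0<e : 0 < e)
  (eq : (a + e) * (x * x) + 4 * a ≡ a * ((x + k) * (x + k)) + 4 * (a + e)) where

  private
    ex²≡ : e * (x * x) ≡ a * (2 * (k * x) + k * k) + 4 * e
    ex²≡ = +-cancelˡ-≡ (a * (x * x) + 4 * a) _ _ (begin
      a * (x * x) + 4 * a + e * (x * x)           ≡⟨ solve (a ∷ e ∷ x ∷ []) ⟩
      (a + e) * (x * x) + 4 * a                   ≡⟨ eq ⟩
      a * ((x + k) * (x + k)) + 4 * (a + e)       ≡⟨ solve (a ∷ e ∷ x ∷ k ∷ []) ⟩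
      a * (x * x) + 4 * a + (a * (2 * (k * x) + k * k) + 4 * e)  ∎)
      where open ≡-Reasoning

  -- The right side of `ex²≡` exceeds 2akx by the positive number ak² + 4e; then x is cancelled.
  2ak<ex : 2 * (a * k) < e * x
  2ak<ex = *-cancelʳ-< x (2 * (a * k)) (e * x) (begin-strict
    2 * (a * k) * x        <⟨ m<m+n _ (<-≤-trans (*-monoʳ-< 4 0<e) (m≤n+m (4 * e) (a * (k * k)))) ⟩
    2 * (a * k) * x + (a * (k * k) + 4 * e) ≡⟨ solve (a ∷ e ∷ x ∷ k ∷ []) ⟩
    a * (2 * (k * x) + k * k) + 4 * e  ≡⟨ ex²≡ ⟨
    e * (x * x)                        ≡⟨ *-assoc e x x ⟨
    e * x * x                          ∎)
    where open ≤-Reasoning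

  -- Multiplying `ex²≡` by e gives a quadratic equation for the product ex, ready for completing the
  -- square.
  [ex]²≡ : e * x * (e * x) ≡ a * e * (2 * (k * x) + k * k) + 4 * (e * e)
  [ex]²≡ = begin
    e * x * (e * x)      ≡⟨ solve (e ∷ x ∷ []) ⟩
    e * (e * (x * x))    ≡⟨ cong (e *_) ex²≡ ⟩
    e * (a * (2 * (k * x) + k * k) + 4 * e) ≡⟨ solve (a ∷ e ∷ x ∷ k ∷ []) ⟩
    a * e * (2 * (k * x) + k * k) + 4 * (e * e) ∎
    where open ≡-Reasoning

-- Here f is ex - a. The last hypothesis is `[ex]²≡` at k = 1; completing the square turns it into
-- f² = a(a + e) + 4e², which is at least r² since e ≥ 1.
r≤ex-a : ∀ {a e x r f} → 0 < e → r * r ≡ a * (a + e) + 4 → e * x ≡ a + f →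
  e * x * (e * x) ≡ a * e * (2 * (1 * x) + 1 * 1) + 4 * (e * e) → r ≤ f
r≤ex-a {a} {e} {x} {r} {f} 0<e r² ex≡a+f [ex]² = ≮⇒≥ λ f<r → <-irrefl refl (begin-strict
  f * f       <⟨ *-mono-< f<r f<r ⟩
  r * r                      ≡⟨ r² ⟩
  a * (a + e) + 4            ≤⟨ +-monoʳ-≤ (a * (a + e)) (*-monoʳ-≤ 4 (*-mono-≤ 0<e 0<e)) ⟩
  a * (a + e) + 4 * (e * e)  ≡⟨ f²≡ ⟨
  f * f                      ∎)
  where
  open ≤-Reasoning
  f²≡ : f * f ≡ a * (a + e) + 4 * (e * e)
  f²≡ = +-cancelˡ-≡ (a * a + 2 * (a * f)) _ _ (begin-equality
    a * a + 2 * (a * f) + f * f       ≡⟨ solve (a ∷ f ∷ []) ⟩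
    (a + f) * (a + f)                 ≡⟨ cong₂ _*_ ex≡a+f ex≡a+f ⟨
    e * x * (e * x)                   ≡⟨ [ex]² ⟩
    a * e * (2 * (1 * x) + 1 * 1) + 4 * (e * e)  ≡⟨ solve (a ∷ e ∷ x ∷ []) ⟩
    2 * a * (e * x) + (a * e + 4 * (e * e))  ≡⟨ cong (λ u → 2 * a * u + (a * e + 4 * (e * e))) ex≡a+f ⟩
    2 * a * (a + f) + (a * e + 4 * (e * e))  ≡⟨ solve (a ∷ e ∷ f ∷ []) ⟩
    a * a + 2 * (a * f) + (a * (a + e) + 4 * (e * e)) ∎)

-- The hypothesis is 2t < 2r + 2s written with b = a + e and y = x + k.
cancel-ax+rx : ∀ {a e r x k} →
  (a + e) * x + r * (x + k) < 2 * r + (a * (x + k) + r * x) → e * x + r * k < 2 * r + a * k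
cancel-ax+rx {a} {e} {r} {x} {k} lt = +-cancelˡ-< (a * x + r * x) (e * x + r * k) (2 * r + a * k) (begin-strict
  a * x + r * x + (e * x + r * k)  ≡⟨ solve (a ∷ e ∷ r ∷ x ∷ k ∷ []) ⟩
  (a + e) * x + r * (x + k)        <⟨ lt ⟩
  2 * r + (a * (x + k) + r * x)    ≡⟨ solve (a ∷ r ∷ x ∷ k ∷ []) ⟩
  a * x + r * x + (2 * r + a * k)  ∎)
  where open ≤-Reasoning

-- Here b = a + e and y = x + k.
no-large-solution : ∀ {a e r x k} → 0 < e → 0 < k → r * r ≡ a * (a + e) + 4 →
  (a + e) * (x * x) + 4 * a ≡ a * ((x + k) * (x + k)) + 4 * (a + e) →
  ¬ ((a + e) * x + r * (x + k) < 2 * r + (a * (x + k) + r * x))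
no-large-solution {a} {e} {r} {x} {k} 0<e 0<k r² eq lt with k ≟ 1
... | no k≢1 = <-asym (cancel-ax+rx {a} {e} {r} {x} {k} lt) (begin-strict
  2 * r + a * k        ≡⟨ cong (_+ a * k) (*-comm 2 r) ⟩
  r * 2 + a * k        ≤⟨ +-mono-≤ (*-monoʳ-≤ r (≤∧≢⇒< 0<k (≢-sym k≢1))) (m≤n*m (a * k) 2) ⟩
  r * k + 2 * (a * k)  <⟨ +-monoʳ-< (r * k) (2ak<ex {a} {e} {x} {k} 0<e eq) ⟩
  r * k + e * x        ≡⟨ +-comm (r * k) (e * x) ⟩
  e * x + r * k        ∎)
  where open ≤-Reasoning
-- Since ex > 2a, the difference ex - a can be written as a + g.
... | yes refl with g , _ , ex≡ ← m<n⇒∃k (2ak<ex {a} {e} {x} {1} 0<e eq) =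
  <⇒≱ f<r (r≤ex-a {a} {e} {x} {r} {a + g} 0<e r² ex≡a+f ([ex]²≡ {a} {e} {x} {1} 0<e eq))
  where
  open ≤-Reasoning
  ex≡a+f : e * x ≡ a + (a + g)
  ex≡a+f = trans ex≡ (solve (a ∷ g ∷ []))
  f<r : a + g < r
  f<r = +-cancelˡ-< (a + r) (a + g) r (begin-strict
    a + r + (a + g)        ≡⟨ solve (a ∷ r ∷ g ∷ []) ⟩
    (a + (a + g)) + r * 1  ≡⟨ cong (_+ r * 1) ex≡a+f ⟨
    e * x + r * 1          <⟨ cancel-ax+rx {a} {e} {r} {x} {1} lt ⟩
    2 * r + a * 1          ≡⟨ solve (a ∷ r ∷ []) ⟩
    a + r + r              ∎)

-- At x = 1 the equation reads ay² = 4a - 3b, which is less than a because a < b.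
x≢1 : ∀ {a b x y} → a < b → 0 < y →
  b * (x * x) + 4 * a ≡ a * (y * y) + 4 * b → x ≢ 1
x≢1 {a} {b} {_} {y} a<b 0<y eq refl = <⇒≢ (begin-strict
  b * (1 * 1) + 4 * a       ≡⟨ solve (a ∷ b ∷ []) ⟩
  (a + b) + 3 * a           <⟨ +-monoʳ-< (a + b) (*-monoʳ-< 3 a<b) ⟩
  (a + b) + 3 * b           ≡⟨ solve (a ∷ b ∷ []) ⟩
  a * (1 * 1) + 4 * b       ≤⟨ +-monoˡ-≤ (4 * b) (*-monoʳ-≤ a (*-mono-≤ 0<y 0<y)) ⟩
  a * (y * y) + 4 * b       ∎) eq
  where open ≤-Reasoning

x≡2⇒y≡2 : ∀ {a b y} → 0 < a → b * (2 * 2) + 4 * a ≡ a * (y * y) + 4 * b → y ≡ 2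
x≡2⇒y≡2 {a} {b} {y} 0<a eq = m*m≡n*n⇒m≡n (*-cancelˡ-≡ (y * y) (2 * 2) a {{>-nonZero 0<a}}
  (+-cancelʳ-≡ (4 * b) (a * (y * y)) (a * (2 * 2)) (begin
    a * (y * y) + 4 * b       ≡⟨ eq ⟨
    b * (2 * 2) + 4 * a       ≡⟨ solve (a ∷ b ∷ []) ⟩
    a * (2 * 2) + 4 * b       ∎)))
  where open ≡-Reasoning

x≯2 : ∀ {a b r x y} → a < b → r * r ≡ a * b + 4 →
  b * (x * x) + 4 * a ≡ a * (y * y) + 4 * b →
  b * x + r * y < 2 * r + (a * y + r * x) → ¬ (2 < x)
x≯2 {a} {r = r} {x} {y} a<b r² eq lt 2<x with e , 0<e , refl ← m<n⇒∃k a<b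
  with k , 0<k , refl ← m<n⇒∃k (2<x⇒x<y {a} {e} {x} {y} 0<e 2<x eq) =
  no-large-solution {a} {e} {r} {x} {k} 0<e 0<k r² eq lt

x≡y≡2 : ∀ {a b r x y} → 0 < a → a < b → r * r ≡ a * b + 4 → 0 < x → 0 < y →
  b * (x * x) + 4 * a ≡ a * (y * y) + 4 * b →
  b * x + r * y < 2 * r + (a * y + r * x) → x ≡ 2 × y ≡ 2
x≡y≡2 {a} {b} {r} {x} {y} 0<a a<b r² 0<x 0<y eq lt = x≡2 , x≡2⇒y≡2 {a} {b} 0<a
  (subst (λ x → b * (x * x) + 4 * a ≡ a * (y * y) + 4 * b) x≡2 eq)
  where
  x≡2 : x ≡ 2
  x≡2 = ≤-antisym (≮⇒≥ (x≯2 {a} {b} {r} {x} {y} a<b r² eq lt))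
    (≤∧≢⇒< 0<x (≢-sym (x≢1 {a} {b} {x} {y} a<b 0<y eq)))

-- Put x = y = 2 into 2s = ay + rx and 2t = bx + ry. It follows that c = a + b + 2r, so the triple
-- is determined by a and b.
s≡a+r×t≡b+r : ∀ {a b c r s t} → 0 < a → a < b → b < c →
  r * r ≡ a * b + 4 → s * s ≡ a * c + 4 → t * t ≡ b * c + 4 →
  t < r + s → s ≡ a + r × t ≡ b + r
s≡a+r×t≡b+r {a} {b} {c} {r} {s} {t} 0<a a<b b<c r²≡ s²≡ t²≡ t<r+s =
  halve a s (trans 2s≡ (cong₂ (λ x y → a * y + r * x) x≡2 y≡2)) ,
  halve b t (trans 2t≡ (cong₂ (λ x y → b * x + r * y) x≡2 y≡2))
  where
  -- Exchanging a with b and s with t exchanges x with y.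
  r²≡′ : r * r ≡ b * a + 4
  r²≡′ = trans r²≡ (cong (_+ 4) (*-comm a b))
  half-x : ∃ λ x → 0 < x × r * s ≡ a * t + 2 * x
  half-x = rs≡at+2x {a} {b} {c} {r} {s} {t} (<⇒≤ (<-trans a<b b<c)) r²≡ s²≡ t²≡
  half-y : ∃ λ y → 0 < y × r * t ≡ b * s + 2 * y
  half-y = rs≡at+2x {b} {a} {c} {r} {t} {s} (<⇒≤ b<c) r²≡′ t²≡ s²≡
  x y : ℕ
  x = proj₁ half-x
  y = proj₁ half-y
  0<x : 0 < x
  0<x = proj₁ (proj₂ half-x)
  0<y : 0 < y
  0<y = proj₁ (proj₂ half-y)
  2s≡ : 2 * s ≡ a * y + r * x
  2s≡ = 2s≡ay+rx {a} {b} {r} {s} {t} {x} {y} r²≡ (proj₂ (proj₂ half-x)) (proj₂ (proj₂ half-y))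
  2t≡ : 2 * t ≡ b * x + r * y
  2t≡ = 2s≡ay+rx {b} {a} {r} {t} {s} {y} {x} r²≡′ (proj₂ (proj₂ half-y)) (proj₂ (proj₂ half-x))
  x≡2×y≡2 : x ≡ 2 × y ≡ 2
  x≡2×y≡2 = x≡y≡2 {a} {b} {r} {x} {y} 0<a a<b r²≡ 0<x 0<y
    (bx²+4a≡ay²+4b {a} {b} {c} {r} {s} {t} {x} {y} r²≡ s²≡ t²≡ 2s≡ 2t≡)
    (subst₂ _<_ 2t≡ (trans (*-distribˡ-+ 2 r s) (cong (2 * r +_) 2s≡)) (*-monoʳ-< 2 t<r+s))
  x≡2 = proj₁ x≡2×y≡2
  y≡2 = proj₂ x≡2×y≡2
  halve : ∀ m n → 2 * n ≡ m * 2 + r * 2 → n ≡ m + r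
  halve m n eq = *-cancelˡ-≡ n (m + r) 2
    (trans eq (trans (sym (*-distribʳ-+ 2 m r)) (*-comm (m + r) 2)))

-- Rational bounds as inequalities between natural numbers.

-- All denominators are 1, so the fractions agree even unnormalised; propositional equality lets
-- `subst` rewrite the bounds.
fromℕ-+ : ∀ m n → fromℕ m ℚ.+ fromℕ n ≡ fromℕ (m + n)
fromℕ-+ m n = cong (λ i → mkℚᵘ i 0)
  (cong₂ ℤ._+_ (ℤ.*-identityʳ (ℤ.+ m)) (ℤ.*-identityʳ (ℤ.+ n)))

fromℕ-* : ∀ m n → fromℕ m ℚ.* fromℕ n ≡ fromℕ (m * n)
fromℕ-* m n = cong (λ i → mkℚᵘ i 0) (sym (ℤ.pos-* m n))

fromℕ-∸ : ∀ {m n} → n ≤ m → fromℕ m ℚ.- fromℕ n ≡ fromℕ (m ∸ n)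
fromℕ-∸ {m} {n} n≤m = cong (λ i → mkℚᵘ i 0) (begin
  ℤ.+ m ℤ.* ℤ.1ℤ ℤ.+ (ℤ.- (ℤ.+ n)) ℤ.* ℤ.1ℤ ≡⟨ cong₂ ℤ._+_ (ℤ.*-identityʳ (ℤ.+ m)) (ℤ.*-identityʳ (ℤ.- (ℤ.+ n))) ⟩
  ℤ.+ m ℤ.+ (ℤ.- (ℤ.+ n))                    ≡⟨ ℤ.m-n≡m⊖n m n ⟩
  m ℤ.⊖ n                                    ≡⟨ ℤ.⊖-≥ n≤m ⟩
  ℤ.+ (m ∸ n)                                ∎)
  where open ≡-Reasoning

fromℕ-mono-< : ∀ {m n} → m < n → fromℕ m ℚ.< fromℕ n
fromℕ-mono-< {m} {n} m<n = *<* (subst₂ ℤ._<_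
  (sym (ℤ.*-identityʳ (ℤ.+ m))) (sym (ℤ.*-identityʳ (ℤ.+ n))) (ℤ.+<+ m<n))

fromℕ-cancel-< : ∀ {m n} → fromℕ m ℚ.< fromℕ n → m < n
fromℕ-cancel-< {m} {n} (*<* m<n) = ℤ.drop‿+<+ (subst₂ ℤ._<_
  (ℤ.*-identityʳ (ℤ.+ m)) (ℤ.*-identityʳ (ℤ.+ n)) m<n)

-- The pairs extended by the regular triple {a, b, a + b + 2r}; its associated
-- triangle is (r, a + r, b + r).
record RegularPair (r a b : ℕ) : Set where
  field
    0<a   : 0 < a
    a<b   : a < b
    b<a+r : b < a + r
    r²≡   : r * r ≡ a * b + 4

module _ {r a b : ℕ} (r²≡ : r * r ≡ a * b + 4) where

  private
    r²-4≡ : r * r ∸ 4 ≡ a * b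
    r²-4≡ = trans (cong (_∸ 4) r²≡) (m+n∸n≡m (a * b) 4)

    -- Arranged to match `[2a+r]²≡`: in 5r² - 16 < (2a + r)² the common ab + 4 drops out, leaving
    -- 4ab < 4a(a + r).
    5r²≡ : 5 * (r * r) ≡ 16 + (a * b + 4 + a * (4 * b))
    5r²≡ = begin
      5 * (r * r)                        ≡⟨ cong (5 *_) r²≡ ⟩
      5 * (a * b + 4)                    ≡⟨ solve (a ∷ b ∷ []) ⟩
      16 + (a * b + 4 + a * (4 * b))     ∎
      where open ≡-Reasoning

    radicand≡ : fromℕ (5 * (r * r)) ℚ.- fromℕ 16 ≡ fromℕ (a * b + 4 + a * (4 * b))
    radicand≡ = trans (cong (λ m → fromℕ m ℚ.- fromℕ 16) 5r²≡)
      (trans (fromℕ-∸ (m≤m+n 16 (a * b + 4 + a * (4 * b)))) (cong fromℕ (m+n∸m≡n 16 (a * b + 4 + a * (4 * b)))))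

    2a+r≡ : (fromℕ a ℚ.+ fromℕ a) ℚ.+ fromℕ r ≡ fromℕ (a + a + r)
    2a+r≡ = trans (cong (ℚ._+ fromℕ r) (fromℕ-+ a a)) (fromℕ-+ (a + a) r)

    [2a+r]²≡ : (a + a + r) * (a + a + r) ≡ a * b + 4 + a * (4 * (a + r))
    [2a+r]²≡ = begin
      (a + a + r) * (a + a + r)          ≡⟨ solve (a ∷ r ∷ []) ⟩
      r * r + a * (4 * (a + r))          ≡⟨ cong (_+ a * (4 * (a + r))) r²≡ ⟩
      a * b + 4 + a * (4 * (a + r))      ∎
      where open ≡-Reasoning

    square≡ : ((fromℕ a ℚ.+ fromℕ a) ℚ.+ fromℕ r) ℚ.* ((fromℕ a ℚ.+ fromℕ a) ℚ.+ fromℕ r)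
      ≡ fromℕ (a * b + 4 + a * (4 * (a + r)))
    square≡ = trans (cong₂ ℚ._*_ 2a+r≡ 2a+r≡)
      (trans (fromℕ-* (a + a + r) (a + a + r)) (cong fromℕ [2a+r]²≡))

    r²-4≡′ : fromℕ (r * r) ℚ.- fromℕ 4 ≡ fromℕ (a * b)
    r²-4≡′ = trans (fromℕ-∸ (≤-trans (m≤n+m 4 (a * b)) (≤-reflexive (sym r²≡)))) (cong fromℕ r²-4≡)

  lower⁺ : 0 < a → b < a + r →
    (√ (fromℕ (5 * (r * r)) ℚ.- fromℕ 16) -ᶜ fromℕ r) /2 <ᶜ fromℕ a
  lower⁺ 0<a b<a+r =
    -- Lying above a square root means being positive and having a larger square; the number tested
    -- is 2a + r.
    subst (0ℚᵘ ℚ.<_) (sym 2a+r≡)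
      (fromℕ-mono-< (<-≤-trans 0<a (≤-trans (m≤m+n a a) (m≤m+n (a + a) r)))) ,
    subst₂ ℚ._<_ (sym radicand≡) (sym square≡)
      (fromℕ-mono-< (+-monoʳ-< (a * b + 4) (*-monoʳ-< a {{>-nonZero 0<a}} (*-monoʳ-< 4 b<a+r))))

  lower⁻ : (√ (fromℕ (5 * (r * r)) ℚ.- fromℕ 16) -ᶜ fromℕ r) /2 <ᶜ fromℕ a → b < a + r
  lower⁻ (_ , lt) =
    *-cancelˡ-< 4 b (a + r) (*-cancelˡ-< a (4 * b) (4 * (a + r))
      (+-cancelˡ-< (a * b + 4) (a * (4 * b)) (a * (4 * (a + r)))
        (fromℕ-cancel-< (subst₂ ℚ._<_ radicand≡ square≡ lt))))

  -- As r² - 4 = ab, the bound on a² amounts to a² < ab.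
  upper⁺ : 0 < a → a < b → fromℕ a ᶜ< √ (fromℕ (r * r) ℚ.- fromℕ 4)
  upper⁺ 0<a a<b = inj₂ (subst₂ ℚ._<_ (sym (fromℕ-* a a)) (sym r²-4≡′)
    (fromℕ-mono-< (*-monoʳ-< a {{>-nonZero 0<a}} a<b)))

  upper⁻ : fromℕ a ᶜ< √ (fromℕ (r * r) ℚ.- fromℕ 4) → a < b
  upper⁻ (inj₁ a<0) = contradiction (fromℕ-cancel-< a<0) n≮0
  upper⁻ (inj₂ lt)  = *-cancelˡ-< a a b
    (fromℕ-cancel-< (subst₂ ℚ._<_ (fromℕ-* a a) r²-4≡′ lt))

regularPair⇒admissible : ∀ {r a b} → RegularPair r a b → IsAdmissibleDivisor r a
regularPair⇒admissible {r} {a} {b} p = record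
  { positive = 0<a
  ; divides  = divides b (trans (cong (_∸ 4) r²≡) (trans (m+n∸n≡m (a * b) 4) (*-comm a b)))
  ; lower    = lower⁺ {r} {a} {b} r²≡ 0<a b<a+r
  ; upper    = upper⁺ {r} {a} {b} r²≡ 0<a a<b
  }
  where open RegularPair p

admissible⇒regularPair : ∀ {r a} → 2 ≤ r → IsAdmissibleDivisor r a → ∃ (RegularPair r a)
admissible⇒regularPair {r} {a} 2≤r adm = b , record
  { 0<a   = positive
  ; a<b   = upper⁻ {r} {a} {b} r²≡ upper
  ; b<a+r = lower⁻ {r} {a} {b} r²≡ lower
  ; r²≡   = r²≡
  }
  where
  open IsAdmissibleDivisor adm renaming (divides to a∣r²-4)
  open _∣_ a∣r²-4 renaming (quotient to b; equality to r²-4≡)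
  r²≡ : r * r ≡ a * b + 4
  -- From r ≥ 2 follows r² ≥ 4, so the truncated difference is the true one.
  r²≡ = trans (sym (m∸n+n≡m (*-mono-≤ 2≤r 2≤r))) (cong (_+ 4) (trans r²-4≡ (*-comm b a)))

-- Finiteness of the set of admissible divisors.

admissible? : ∀ r → Decidable (IsAdmissibleDivisor r)
admissible? r a = map′
  (λ (p , d , l , u) → record { positive = p ; divides = d ; lower = l ; upper = u })
  (λ adm → let open IsAdmissibleDivisor adm renaming (divides to a∣r²-4) in positive , a∣r²-4 , lower , upper)
  -- The two cut conditions unfold to a conjunction and a disjunction of rational comparisons.
  (0 <? a ×-dec a ∣? _ ×-dec (0ℚᵘ ℚ.<? _ ×-dec _ ℚ.<? _) ×-dec (_ ℚ.<? 0ℚᵘ ⊎-dec _ ℚ.<? _))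

-- The smaller factor of r² - 4 lies below r; this bounds the search for divisors.
regularPair⇒a<r : ∀ {r a b} → RegularPair r a b → a < r
regularPair⇒a<r {r} {a} {b} p = m*m<n*n⇒m<n (begin-strict
  a * a      ≤⟨ *-monoʳ-≤ a (<⇒≤ a<b) ⟩
  a * b      <⟨ m<m+n (a * b) z<s ⟩
  a * b + 4  ≡⟨ r²≡ ⟨
  r * r      ∎)
  where
  open RegularPair p
  open ≤-Reasoning

-- Distinct positions of a duplicate-free list hold distinct entries, so the position does not
-- depend on the membership proof.
index-unique : ∀ {A : Set} {xs : List A} {x} → Unique xs →
  (x∈xs : x ∈ xs) (i : Fin (length xs)) → x ≡ lookup xs i → index x∈xs ≡ i
index-unique _          (here _)     Fin.zero    _  = refl
index-unique (y∉ AllPairs.∷ _)   (here refl)  (Fin.suc i) eq = contradiction eq (All.lookup y∉ (∈-lookup i))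
index-unique (y∉ AllPairs.∷ _)   (there x∈xs) Fin.zero    eq = contradiction (sym eq) (All.lookup y∉ x∈xs)
index-unique (_ AllPairs.∷ uniq) (there x∈xs) (Fin.suc i) eq = cong Fin.suc (index-unique uniq x∈xs i eq)

-- The numbers below n that pass the test form a duplicate-free list, and positions in it are the
-- required numbering.
bounded-decidable-finite : ∀ {P : ℕ → Set} n → Decidable P → (∀ {m} → P m → m < n) →
  ∃ (HasCardinality (On.setoid {B = ∃ P} (setoid ℕ) proj₁))
bounded-decidable-finite {P} n P? bound = length xs , record
  { to        = λ (m , pm) → index (m∈xs pm)
  ; from      = λ i → lookup xs i , proj₂ (∈-filter⁻ P? {xs = upTo n} (∈-lookup i))
  ; to-cong   = λ {x} {y} x≡y → index-unique uniq (m∈xs (proj₂ x)) (index (m∈xs (proj₂ y)))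
                  (trans x≡y (lookup-index (m∈xs (proj₂ y))))
  ; from-cong = cong (lookup xs)
  ; inverse   = (λ {i} {x} x≡ → index-unique uniq (m∈xs (proj₂ x)) i x≡)
              , λ { {_ , pm} refl → sym (lookup-index (m∈xs pm)) }
  }
  where
  xs = filter P? (upTo n)
  uniq : Unique xs
  uniq = filter⁺ P? (upTo⁺ n)
  m∈xs : ∀ {m} → P m → m ∈ xs
  m∈xs pm = ∈-filter⁺ P? (∈-upTo⁺ (bound pm)) pm

admissibleDivisors-finite : ∀ r → 2 ≤ r → ∃ (HasCardinality (AdmissibleDivisors r))
admissibleDivisors-finite r 2≤r = bounded-decidable-finite r (admissible? r)
  λ adm → regularPair⇒a<r (proj₂ (admissible⇒regularPair 2≤r adm))

-- Triples, regular pairs and their triangles.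

module _ (D : D4Triple) where
  open D4Triple D

  r<s : r < s
  r<s = m*m<n*n⇒m<n (subst₂ _<_ (sym r²≡) (sym s²≡) (+-monoˡ-< 4 (*-monoʳ-< a {{>-nonZero 0<a}} b<c)))

  s<t : s < t
  s<t = m*m<n*n⇒m<n (subst₂ _<_ (sym s²≡) (sym t²≡)
    (+-monoˡ-< 4 (*-monoˡ-< c {{>-nonZero (≤-<-trans z≤n b<c)}} a<b)))

  regularPair : t < r + s → RegularPair r a b
  regularPair t<r+s = let s≡ , t≡ = s≡a+r×t≡b+r 0<a a<b b<c r²≡ s²≡ t²≡ t<r+s in record
    { 0<a   = 0<a
    ; a<b   = a<b
    ; b<a+r = +-cancelʳ-< r b (a + r) (subst₂ _<_ t≡ (trans (cong (r +_) s≡) (+-comm r (a + r))) t<r+s)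
    ; r²≡   = r²≡
    }

regularTriple : ∀ {r a b} → RegularPair r a b → D4Triple
regularTriple {r} {a} {b} p = record
  -- This c is forced by (a + r)² = ac + 4: expand, replace r² by ab + 4 and divide by a.
  { a = a ; b = b ; c = a + b + 2 * r
  ; 0<a = 0<a
  ; a<b = a<b
  ; b<c = ≤-trans (+-monoˡ-< b 0<a) (m≤m+n (a + b) (2 * r))
  ; r = r ; s = a + r ; t = b + r
  ; r²≡ = r²≡
  ; s²≡ = begin
      (a + r) * (a + r)            ≡⟨ solve (a ∷ r ∷ []) ⟩
      a * a + 2 * a * r + r * r    ≡⟨ cong (a * a + 2 * a * r +_) r²≡ ⟩
      a * a + 2 * a * r + (a * b + 4)  ≡⟨ solve (a ∷ b ∷ r ∷ []) ⟩
      a * (a + b + 2 * r) + 4      ∎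
  ; t²≡ = begin
      (b + r) * (b + r)            ≡⟨ solve (b ∷ r ∷ []) ⟩
      b * b + 2 * b * r + r * r    ≡⟨ cong (b * b + 2 * b * r +_) r²≡ ⟩
      b * b + 2 * b * r + (a * b + 4)  ≡⟨ solve (a ∷ b ∷ r ∷ []) ⟩
      b * (a + b + 2 * r) + 4      ∎
  }
  where
  open RegularPair p
  open ≡-Reasoning

regularTriangle : ∀ {r a b} → RegularPair r a b → Triangle
regularTriangle {r} {a} {b} p = record
  { x = r ; y = a + r ; z = b + r
  ; x<y+z = <-≤-trans (m<n+m r 0<a) (m≤m+n (a + r) (b + r))
  ; y<x+z = <-≤-trans (+-monoˡ-< r a<b) (m≤n+m (b + r) r)
  ; z<x+y = <-≤-trans (+-monoˡ-< r b<a+r) (≤-reflexive (+-comm (a + r) r))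
  }
  where open RegularPair p

-- The triangle inequalities in a form that treats all sides alike, so that it passes through any
-- permutation of the sides.
side+side<perimeter : ∀ T → All (λ u → u + u < sum (sides T)) (sides T)
side+side<perimeter record { x = x ; y = y ; z = z ; x<y+z = x<y+z ; y<x+z = y<x+z ; z<x+y = z<x+y } =
  (begin-strict
    x + x               <⟨ +-monoʳ-< x x<y+z ⟩
    x + (y + z)         ≡⟨ solve (x ∷ y ∷ z ∷ []) ⟩
    x + (y + (z + 0))   ∎) All.∷
  (begin-strict
    y + y               <⟨ +-monoʳ-< y y<x+z ⟩
    y + (x + z)         ≡⟨ solve (x ∷ y ∷ z ∷ []) ⟩
    x + (y + (z + 0))   ∎) All.∷
  (begin-strict
    z + z               <⟨ +-monoʳ-< z z<x+y ⟩
    z + (x + y)         ≡⟨ solve (x ∷ y ∷ z ∷ []) ⟩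
    x + (y + (z + 0))   ∎) All.∷ All.[]
  where open ≤-Reasoning

module _ {T : Triangle} {D : D4Triple} (T~D : T IsAssociatedWith D) where
  open D4Triple D

  t<r+s : t < r + s
  -- After the permutation the third entry concerns t, and the perimeter is r + s + t.
  t<r+s with _ All.∷ _ All.∷ 2t< All.∷ All.[] ← All-resp-↭ T~D (side+side<perimeter T) =
    +-cancelˡ-< t t (r + s) (begin-strict
      t + t              <⟨ 2t< ⟩
      sum (sides T)      ≡⟨ sum-↭ T~D ⟩
      r + (s + (t + 0))  ≡⟨ perimeter≡ r s t ⟩
      t + (r + s)        ∎)
    where
    open ≤-Reasoning
    perimeter≡ : ∀ x y z → x + (y + (z + 0)) ≡ z + (x + y)
    perimeter≡ x y z = solve (x ∷ y ∷ z ∷ [])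

  -- Because r < s < t, both ρ and r are the minimum of the same three sides.
  shortestSide≡r : ∀ {ρ} → HasShortestSide ρ T → ρ ≡ r
  shortestSide≡r (ρ∈ , ρ≤) = ≤-antisym
    (All.head (All-resp-↭ T~D ρ≤))
    (All.lookup (≤-refl All.∷ <⇒≤ (r<s D) All.∷ <⇒≤ (<-trans (r<s D) (s<t D)) All.∷ All.[]) (∈-resp-↭ T~D ρ∈))

  associated⇒↭ : sides T ↭ r ∷ a + r ∷ b + r ∷ []
  associated⇒↭ = let s≡ , t≡ = s≡a+r×t≡b+r 0<a a<b b<c r²≡ s²≡ t²≡ t<r+s in
    ↭-trans T~D (↭-reflexive (cong₂ (λ s t → r ∷ s ∷ t ∷ []) s≡ t≡))

-- The minimum of the left list is a + r, hence it is at most the entry a′ + r. Used in both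
-- directions it recovers a from the triangle.
↭⇒a≤a′ : ∀ {r a b a′ b′} → a < b → a + r ∷ b + r ∷ [] ↭ a′ + r ∷ b′ + r ∷ [] → a ≤ a′
↭⇒a≤a′ {r} {a} {b} {a′} a<b σ = +-cancelʳ-≤ r a a′ (All.head (All-resp-↭ σ a+r≤))
  where
  a+r≤ : All (a + r ≤_) (a + r ∷ b + r ∷ [])
  a+r≤ = ≤-refl All.∷ +-monoˡ-≤ r (<⇒≤ a<b) All.∷ All.[]

associated⇒regular : ∀ {ρ} T D → T IsAssociatedWith D → HasShortestSide ρ T →
  let open D4Triple D in RegularPair ρ a b × sides T ↭ ρ ∷ a + ρ ∷ b + ρ ∷ []
associated⇒regular T D T~D shortest =
  subst (λ ρ → RegularPair ρ a b × sides T ↭ ρ ∷ a + ρ ∷ b + ρ ∷ [])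
    (sym (shortestSide≡r {T} {D} T~D shortest))
    (regularPair D (t<r+s {T} {D} T~D) , associated⇒↭ {T} {D} T~D)
  where open D4Triple D

-- The product ab = ρ² - 4 is fixed, so a determines b.
regularPair-sides≡ : ∀ {ρ a b a′ b′} → RegularPair ρ a b → RegularPair ρ a′ b′ → a ≡ a′ →
  ρ ∷ a + ρ ∷ b + ρ ∷ [] ≡ ρ ∷ a′ + ρ ∷ b′ + ρ ∷ []
regularPair-sides≡ {ρ} {a} {b} {_} {b′} p p′ refl = cong (λ b → ρ ∷ a + ρ ∷ b + ρ ∷ [])
  (*-cancelˡ-≡ b b′ a {{>-nonZero (RegularPair.0<a p)}} (+-cancelʳ-≡ 4 (a * b) (a * b′)
    (trans (sym (RegularPair.r²≡ p)) (RegularPair.r²≡ p′))))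

-- The bijection between triangles and divisors, and the count.

module _ (ρ : ℕ) (2≤ρ : 2 ≤ ρ) where

  private
    module 𝕋 = Setoid (AssociatedTriangles ρ)
    module 𝔻 = Setoid (AdmissibleDivisors ρ)

    regular : ∀ {a} → IsAdmissibleDivisor ρ a → ∃ (RegularPair ρ a)
    regular = admissible⇒regularPair 2≤ρ

    to : 𝕋.Carrier → 𝔻.Carrier
    to (T , (D , T~D) , shortest) =
      D4Triple.a D , regularPair⇒admissible (proj₁ (associated⇒regular T D T~D shortest))

    from : 𝔻.Carrier → 𝕋.Carrier
    from (a , adm) = regularTriangle p , (regularTriple p , ↭-refl) ,
      here refl , ≤-refl All.∷ m≤n+m ρ a All.∷ m≤n+m ρ (proj₁ (regular adm)) All.∷ All.[]
      where p = proj₂ (regular adm)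

    -- Congruent triangles may carry different triples. Dropping the common side ρ leaves two lists
    -- with equal minima a + ρ and a′ + ρ.
    to-cong : ∀ X Y → X 𝕋.≈ Y → to X 𝔻.≈ to Y
    to-cong (T , (D , T~D) , shortest) (T′ , (D′ , T′~D′) , shortest′) T≈T′ =
      ≤-antisym (↭⇒a≤a′ (D4Triple.a<b D) τ) (↭⇒a≤a′ (D4Triple.a<b D′) (↭-sym τ))
      where
      open D4Triple D
      open D4Triple D′ using () renaming (a to a′; b to b′)
      τ : a + ρ ∷ b + ρ ∷ [] ↭ a′ + ρ ∷ b′ + ρ ∷ []
      τ = drop-∷ (↭-trans (↭-sym (proj₂ (associated⇒regular T D T~D shortest)))
        (↭-trans T≈T′ (proj₂ (associated⇒regular T′ D′ T′~D′ shortest′))))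

    from-cong : ∀ x y → x 𝔻.≈ y → from x 𝕋.≈ from y
    from-cong (_ , adm) (_ , adm′) a≡a′ =
      ↭-reflexive (regularPair-sides≡ (proj₂ (regular adm)) (proj₂ (regular adm′)) a≡a′)

    -- `from` recomputes b as the cofactor of a in ρ² - 4, which agrees with the b of the given
    -- triple.
    from∘to : ∀ X → from (to X) 𝕋.≈ X
    from∘to X@(T , (D , T~D) , shortest) = let p , σ = associated⇒regular T D T~D shortest in
      ↭-trans (↭-reflexive (regularPair-sides≡ (proj₂ (regular (proj₂ (to X)))) p refl)) (↭-sym σ)

  associatedTriangles↔admissibleDivisors :
    Inverse (AssociatedTriangles ρ) (AdmissibleDivisors ρ)
  associatedTriangles↔admissibleDivisors = record
    { to        = to
    ; from      = from
    ; to-cong   = λ {X} {Y} → to-cong X Y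
    ; from-cong = λ {x} {y} → from-cong x y
    -- The divisor underlying `to (from x)` is that of `x` by computation, so congruence suffices.
    ; inverse   = (λ {x} {X} → to-cong X (from x))
                , λ {X} {x} x≡toX → ↭-trans (from-cong x (to X) x≡toX) (from∘to X)
    }

corollary4p4 : (r : ℕ) → 4 ≤ r →
    ∃ λ N → HasCardinality (AssociatedTriangles r) N × HasCardinality (AdmissibleDivisors r) N
corollary4p4 r 4≤r =
  let 2≤r     = ≤-trans (m≤m+n 2 2) 4≤r
      N , fin = admissibleDivisors-finite r 2≤r
  in N , Compose.inverse (associatedTriangles↔admissibleDivisors r 2≤r) fin , fin
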